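{- In the theory $QT^+$ the following are provable: (a) $\mathrm{Addtally}(x,y,v)\wedge\mathrm{Addtally}(x,y,w)\to v=w$; (b) $\mathrm{Tally}_b(x)\to\mathrm{Addtally}(x,b,x)$; (c) $\mathrm{Tally}_b(y)\to\mathrm{Addtally}(b,y,y)$; (d) $\mathrm{Tally}_b(x)\to\mathrm{Addtally}(x,bb,Sx)$; (e) $\mathrm{Tally}_b(x)\wedge\mathrm{Tally}_b(y)\to(\mathrm{Addtally}(x,y,z)\to\mathrm{Addtally}(x,y*b,z*b))$.
   Context: $QT^+$ is the first-order theory in the language $\{a,b,*,S\}$ with axioms the universal closures of: (QT1) $x*(y*z)=(x*y)*z$; (QT2) $\neg(x*y=a)\wedge\neg(x*y=b)$; (QT3) $(x*a=y*a\to x=y)\wedge(x*b=y*b\to x=y)\wedge(a*x=a*y\to x=y)\wedge(b*x=b*y\to x=y)$; (QT4) $\neg(a*x=b*y)\wedge\neg(x*a=y*b)$; (QT5) $x=a\vee x=b\vee(\exists y(a*y=x\vee b*y=x)\wedge\exists z(z*a=x\vee z*b=x))$; (QT6) $Sx=y\leftrightarrow((x=a\wedge y=b)\vee(\neg x=a\wedge x*b=y))$. We write $bb$ for $b*b$. Abbreviations: $xBy\equiv\exists z\,(x*z=y)$; $xEy\equiv\exists z\,(z*x=y)$; $x\subseteq_p y\equiv x=y\vee xBy\vee xEy\vee\exists y_1\exists y_2\,(y=y_1*(x*y_2))$; $\mathrm{Tally}_b(x)\equiv\forall y\,(y\subseteq_p x\wedge(y=a\vee y=b)\to y=b)$. $\mathrm{Addtally}(x,y,z)$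 abbreviates: $(\mathrm{Tally}_b(x)\wedge\mathrm{Tally}_b(y)\wedge((x=b\wedge z=y)\vee(y=b\wedge z=x)\vee\exists x_1,y_1(\mathrm{Tally}_b(x_1)\wedge x=Sx_1\wedge\mathrm{Tally}_b(y_1)\wedge y=Sy_1\wedge z=x*y_1))))\vee((\neg\mathrm{Tally}_b(x)\vee\neg\mathrm{Tally}_b(y))\wedge z=b)$. -}

module Defs where

open import Data.Product using (Σ; ∃; _×_; _,_)
open import Data.Sum using (_⊎_)
open import Relation.Nullary using (¬_)
open import Relation.Binary.PropositionalEquality using (_≡_)

-- Classical excluded middle (for Set-level propositions), used as a
-- hypothesis so that the semantic reading matches classical first-order
-- validity.
LEM : Set₁
LEM = (P : Set) → P ⊎ ¬ P

record QTModel : Set₁ where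
  infixl 7 _*_
  field
    Carrier : Set
    a b     : Carrier
    _*_     : Carrier → Carrier → Carrier
    S       : Carrier → Carrier
    QT1 : ∀ x y z → x * (y * z) ≡ (x * y) * z
    QT2 : ∀ x y → ¬ (x * y ≡ a) × ¬ (x * y ≡ b)
    QT3 : ∀ x y → (x * a ≡ y * a → x ≡ y) × (x * b ≡ y * b → x ≡ y)
                × (a * x ≡ a * y → x ≡ y) × (b * x ≡ b * y → x ≡ y)
    QT4 : ∀ x y → ¬ (a * x ≡ b * y) × ¬ (x * a ≡ y * b)
    QT5 : ∀ x → x ≡ a ⊎ x ≡ b
                ⊎ ((Σ Carrier λ y → a * y ≡ x ⊎ b * y ≡ x)
                   × (Σ Carrier λ z → z * a ≡ x ⊎ z * b ≡ x))
    QT6 : ∀ x y → (S x ≡ y → (x ≡ a × y ≡ b) ⊎ (¬ (x ≡ a) × x * b ≡ y))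
                × ((x ≡ a × y ≡ b) ⊎ (¬ (x ≡ a) × x * b ≡ y) → S x ≡ y)

module Notions (M : QTModel) where
  open QTModel M

  bb : Carrier
  bb = b * b

  _B_ : Carrier → Carrier → Set
  x B y = Σ Carrier λ z → x * z ≡ y

  _E_ : Carrier → Carrier → Set
  x E y = Σ Carrier λ z → z * x ≡ y

  _⊆p_ : Carrier → Carrier → Set
  x ⊆p y = x ≡ y ⊎ x B y ⊎ x E y
           ⊎ (Σ Carrier λ y₁ → Σ Carrier λ y₂ → y ≡ y₁ * (x * y₂))

  Tally : Carrier → Set
  Tally x = ∀ y → y ⊆p x × (y ≡ a ⊎ y ≡ b) → y ≡ b

  Addtally : Carrier → Carrier → Carrier → Set
  Addtally x y z =
      (Tally x × Tally y ×
        ((x ≡ b × z ≡ y) ⊎ (y ≡ b × z ≡ x)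
         ⊎ (Σ Carrier λ x₁ → Σ Carrier λ y₁ →
              Tally x₁ × x ≡ S x₁ × Tally y₁ × y ≡ S y₁ × z ≡ x * y₁)))
    ⊎ ((¬ Tally x ⊎ ¬ Tally y) × z ≡ b)

{-# OPTIONS --safe #-}
-- Tally_b x says that the letter a does not occur in x.  Every factorisation
-- of y * b is a factorisation of y followed by b (look at the last letter of
-- the right-hand factor with QT5 and cancel b with QT3), so a occurs in y * b
-- only if it occurs in y; hence tallies are closed under S x = x * b, and a
-- tally is b or the successor of a tally.  Since S is injective on tallies
-- and never equals b, the clauses of Addtally agree wherever they overlap,
-- which gives (a); (b)-(e) are then checked clause by clause.
module Submission where

open import Defs
open import Data.Product using (Σ; _×_; _,_; proj₁; proj₂)
open import Data.Sum using (_⊎_; inj₁; inj₂; [_,_])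
open import Data.Empty using (⊥-elim)
open import Relation.Nullary using (¬_)
open import Relation.Binary.PropositionalEquality
  using (_≡_; refl; sym; trans; cong; subst; module ≡-Reasoning)

module QTProperties (M : QTModel) where
  open QTModel M
  open Notions M

  variable
    x y z u v w : Carrier

  a≢b : ¬ a ≡ b
  a≢b a≡b = proj₁ (QT4 a a) (cong (_* a) a≡b)

  *≢a : ¬ x * y ≡ a
  *≢a {x} {y} = proj₁ (QT2 x y)

  *≢b : ¬ x * y ≡ b
  *≢b {x} {y} = proj₂ (QT2 x y)

  *a≢*b : ¬ x * a ≡ y * b
  *a≢*b {x} {y} = proj₂ (QT4 x y)

  *b-injective : x * b ≡ y * b → x ≡ y
  *b-injective {x} {y} = proj₁ (proj₂ (QT3 x y))

  S≡*b : ¬ x ≡ a → S x ≡ x * b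
  S≡*b {x} x≢a = proj₂ (QT6 x (x * b)) (inj₂ (x≢a , refl))

  factor-*b : w * u ≡ y * b → w ≡ y ⊎ w B y
  factor-*b {w} {u} wu≡yb with QT5 u
  ... | inj₁ refl = ⊥-elim (*a≢*b wu≡yb)
  ... | inj₂ (inj₁ refl) = inj₁ (*b-injective wu≡yb)
  ... | inj₂ (inj₂ (_ , v , inj₁ refl)) = ⊥-elim (*a≢*b (trans (sym (QT1 w v a)) wu≡yb))
  ... | inj₂ (inj₂ (_ , v , inj₂ refl)) = inj₂ (v , *b-injective (trans (sym (QT1 w v b)) wu≡yb))

  ⊆p-*b : x ⊆p y → x ⊆p (y * b)
  ⊆p-*b (inj₁ refl) = inj₂ (inj₁ (b , refl))
  ⊆p-*b {x} (inj₂ (inj₁ (v , xv≡y))) = inj₂ (inj₁ (v * b , trans (QT1 x v b) (cong (_* b) xv≡y)))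
  ⊆p-*b {x} (inj₂ (inj₂ (inj₁ (v , vx≡y)))) =
    inj₂ (inj₂ (inj₂ (v , b , trans (cong (_* b) (sym vx≡y)) (sym (QT1 v x b)))))
  ⊆p-*b {x} {y} (inj₂ (inj₂ (inj₂ (y₁ , y₂ , y≡y₁xy₂)))) = inj₂ (inj₂ (inj₂ (y₁ , y₂ * b , eq)))
    where
    open ≡-Reasoning
    eq : y * b ≡ y₁ * (x * (y₂ * b))
    eq = begin
      y * b                ≡⟨ cong (_* b) y≡y₁xy₂ ⟩
      y₁ * (x * y₂) * b    ≡⟨ sym (QT1 y₁ (x * y₂) b) ⟩
      y₁ * (x * y₂ * b)    ≡⟨ cong (y₁ *_) (sym (QT1 x y₂ b)) ⟩
      y₁ * (x * (y₂ * b))  ∎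

  a⊆p*b⇒a⊆p : a ⊆p (y * b) → a ⊆p y
  a⊆p*b⇒a⊆p (inj₁ a≡yb) = ⊥-elim (*≢a (sym a≡yb))
  a⊆p*b⇒a⊆p (inj₂ (inj₁ (_ , au≡yb))) with factor-*b au≡yb
  ... | inj₁ a≡y = inj₁ a≡y
  ... | inj₂ aBy = inj₂ (inj₁ aBy)
  a⊆p*b⇒a⊆p (inj₂ (inj₂ (inj₁ (_ , ua≡yb)))) = ⊥-elim (*a≢*b ua≡yb)
  a⊆p*b⇒a⊆p (inj₂ (inj₂ (inj₂ (y₁ , u , yb≡y₁au)))) with factor-*b (sym (trans yb≡y₁au (QT1 y₁ a u)))
  ... | inj₁ y₁a≡y = inj₂ (inj₂ (inj₁ (y₁ , y₁a≡y)))
  ... | inj₂ (v , y₁av≡y) = inj₂ (inj₂ (inj₂ (y₁ , v , trans (sym y₁av≡y) (sym (QT1 y₁ a v)))))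

  Tally⇒¬a⊆p : Tally x → ¬ a ⊆p x
  Tally⇒¬a⊆p tx a⊆px = a≢b (tx a (a⊆px , inj₁ refl))

  ¬a⊆p⇒Tally : ¬ a ⊆p x → Tally x
  ¬a⊆p⇒Tally ¬a⊆px _ (a⊆px , inj₁ refl) = ⊥-elim (¬a⊆px a⊆px)
  ¬a⊆p⇒Tally _     _ (_    , inj₂ y≡b)  = y≡b

  Tally⇒≢a : Tally x → ¬ x ≡ a
  Tally⇒≢a tx refl = Tally⇒¬a⊆p tx (inj₁ refl)

  Tally-b : Tally b
  Tally-b = ¬a⊆p⇒Tally ¬a⊆pb
    where
    ¬a⊆pb : ¬ a ⊆p b
    ¬a⊆pb (inj₁ a≡b) = a≢b a≡b
    ¬a⊆pb (inj₂ (inj₁ (_ , au≡b))) = *≢b au≡b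
    ¬a⊆pb (inj₂ (inj₂ (inj₁ (_ , ua≡b)))) = *≢b ua≡b
    ¬a⊆pb (inj₂ (inj₂ (inj₂ (_ , _ , b≡y₁ay₂)))) = *≢b (sym b≡y₁ay₂)

  Tally-*b : Tally x → Tally (x * b)
  Tally-*b tx = ¬a⊆p⇒Tally (λ a⊆pxb → Tally⇒¬a⊆p tx (a⊆p*b⇒a⊆p a⊆pxb))

  Tally-*b⁻¹ : Tally (x * b) → Tally x
  Tally-*b⁻¹ txb = ¬a⊆p⇒Tally (λ a⊆px → Tally⇒¬a⊆p txb (⊆p-*b a⊆px))

  Tally-bb : Tally bb
  Tally-bb = Tally-*b Tally-b

  S-Tally : Tally x → S x ≡ x * b
  S-Tally tx = S≡*b (Tally⇒≢a tx)

  S-Tally≢b : Tally x → ¬ S x ≡ b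
  S-Tally≢b tx Sx≡b = *≢b (trans (sym (S-Tally tx)) Sx≡b)

  S-Tally-injective : Tally x → Tally y → S x ≡ S y → x ≡ y
  S-Tally-injective tx ty Sx≡Sy = *b-injective (trans (sym (S-Tally tx)) (trans Sx≡Sy (S-Tally ty)))

  Tally⇒b⊎S : Tally x → x ≡ b ⊎ Σ Carrier (λ x₁ → Tally x₁ × x ≡ S x₁)
  Tally⇒b⊎S {x} tx with QT5 x
  ... | inj₁ x≡a = ⊥-elim (Tally⇒≢a tx x≡a)
  ... | inj₂ (inj₁ x≡b) = inj₁ x≡b
  ... | inj₂ (inj₂ (_ , x₁ , inj₁ x₁a≡x)) = ⊥-elim (Tally⇒¬a⊆p tx (inj₂ (inj₂ (inj₁ (x₁ , x₁a≡x)))))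
  ... | inj₂ (inj₂ (_ , x₁ , inj₂ refl)) = inj₂ (x₁ , tx₁ , sym (S-Tally tx₁))
    where
    tx₁ : Tally x₁
    tx₁ = Tally-*b⁻¹ tx

  TallySum : Carrier → Carrier → Carrier → Set
  TallySum x y z =
    (x ≡ b × z ≡ y) ⊎ (y ≡ b × z ≡ x)
    ⊎ (Σ Carrier λ x₁ → Σ Carrier λ y₁ →
         Tally x₁ × x ≡ S x₁ × Tally y₁ × y ≡ S y₁ × z ≡ x * y₁)

  TallySum-functional : TallySum x y v → TallySum x y w → v ≡ w
  TallySum-functional (inj₁ (_ , v≡y)) (inj₁ (_ , w≡y)) = trans v≡y (sym w≡y)
  TallySum-functional (inj₁ (x≡b , v≡y)) (inj₂ (inj₁ (y≡b , w≡x))) =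
    trans v≡y (trans y≡b (trans (sym x≡b) (sym w≡x)))
  TallySum-functional (inj₂ (inj₁ (y≡b , v≡x))) (inj₁ (x≡b , w≡y)) =
    trans v≡x (trans x≡b (trans (sym y≡b) (sym w≡y)))
  TallySum-functional (inj₂ (inj₁ (_ , v≡x))) (inj₂ (inj₁ (_ , w≡x))) = trans v≡x (sym w≡x)
  TallySum-functional (inj₁ (x≡b , _)) (inj₂ (inj₂ (_ , _ , tx₁ , x≡Sx₁ , _))) =
    ⊥-elim (S-Tally≢b tx₁ (trans (sym x≡Sx₁) x≡b))
  TallySum-functional (inj₂ (inj₂ (_ , _ , tx₁ , x≡Sx₁ , _))) (inj₁ (x≡b , _)) =
    ⊥-elim (S-Tally≢b tx₁ (trans (sym x≡Sx₁) x≡b))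
  TallySum-functional (inj₂ (inj₁ (y≡b , _))) (inj₂ (inj₂ (_ , _ , _ , _ , ty₁ , y≡Sy₁ , _))) =
    ⊥-elim (S-Tally≢b ty₁ (trans (sym y≡Sy₁) y≡b))
  TallySum-functional (inj₂ (inj₂ (_ , _ , _ , _ , ty₁ , y≡Sy₁ , _))) (inj₂ (inj₁ (y≡b , _))) =
    ⊥-elim (S-Tally≢b ty₁ (trans (sym y≡Sy₁) y≡b))
  TallySum-functional {x = x}
    (inj₂ (inj₂ (_ , y₁ , _ , _ , ty₁ , y≡Sy₁ , v≡xy₁)))
    (inj₂ (inj₂ (_ , y₁′ , _ , _ , ty₁′ , y≡Sy₁′ , w≡xy₁′))) =
    trans v≡xy₁ (trans (cong (x *_) y₁≡y₁′) (sym w≡xy₁′))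
    where
    y₁≡y₁′ : y₁ ≡ y₁′
    y₁≡y₁′ = S-Tally-injective ty₁ ty₁′ (trans (sym y≡Sy₁) y≡Sy₁′)

  ¬[¬Tally⊎¬Tally] : Tally x → Tally y → ¬ (¬ Tally x ⊎ ¬ Tally y)
  ¬[¬Tally⊎¬Tally] tx ty = [ (λ ¬tx → ¬tx tx) , (λ ¬ty → ¬ty ty) ]

  Addtally-functional : Addtally x y v → Addtally x y w → v ≡ w
  Addtally-functional (inj₁ (_ , _ , sv)) (inj₁ (_ , _ , sw)) = TallySum-functional sv sw
  Addtally-functional (inj₂ (_ , v≡b)) (inj₂ (_ , w≡b)) = trans v≡b (sym w≡b)
  Addtally-functional (inj₁ (tx , ty , _)) (inj₂ (nt , _)) = ⊥-elim (¬[¬Tally⊎¬Tally] tx ty nt)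
  Addtally-functional (inj₂ (nt , _)) (inj₁ (tx , ty , _)) = ⊥-elim (¬[¬Tally⊎¬Tally] tx ty nt)

  Addtally-b-right : Tally x → Addtally x b x
  Addtally-b-right tx = inj₁ (tx , Tally-b , inj₂ (inj₁ (refl , refl)))

  Addtally-b-left : Tally y → Addtally b y y
  Addtally-b-left ty = inj₁ (Tally-b , ty , inj₁ (refl , refl))

  Addtally-bb : Tally x → Addtally x bb (S x)
  Addtally-bb {x} tx = inj₁ (tx , Tally-bb , sum (Tally⇒b⊎S tx))
    where
    sum : x ≡ b ⊎ Σ Carrier (λ x₁ → Tally x₁ × x ≡ S x₁) → TallySum x bb (S x)
    sum (inj₁ refl) = inj₁ (refl , S-Tally Tally-b)
    sum (inj₂ (x₁ , tx₁ , x≡Sx₁)) =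
      inj₂ (inj₂ (x₁ , b , tx₁ , x≡Sx₁ , Tally-b , sym (S-Tally Tally-b) , S-Tally tx))

  Addtally-*b : Tally x → Tally y → Addtally x y z → Addtally x (y * b) (z * b)
  Addtally-*b tx ty (inj₂ (nt , _)) = ⊥-elim (¬[¬Tally⊎¬Tally] tx ty nt)
  Addtally-*b tx ty (inj₁ (_ , _ , inj₁ (refl , refl))) = Addtally-b-left (Tally-*b ty)
  Addtally-*b {x} tx ty (inj₁ (_ , _ , inj₂ (inj₁ (refl , refl)))) =
    subst (Addtally x bb) (S-Tally tx) (Addtally-bb tx)
  Addtally-*b {x} {y} tx ty (inj₁ (_ , _ , inj₂ (inj₂ (x₁ , y₁ , tx₁ , x≡Sx₁ , ty₁ , y≡Sy₁ , refl)))) =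
    inj₁ (tx , Tally-*b ty , inj₂ (inj₂ (x₁ , y , tx₁ , x≡Sx₁ , ty , sym (S-Tally ty) , eq)))
    where
    open ≡-Reasoning
    eq : x * y₁ * b ≡ x * y
    eq = begin
      x * y₁ * b    ≡⟨ sym (QT1 x y₁ b) ⟩
      x * (y₁ * b)  ≡⟨ cong (x *_) (sym (S-Tally ty₁)) ⟩
      x * S y₁      ≡⟨ cong (x *_) (sym y≡Sy₁) ⟩
      x * y         ∎

mainTheorem6 : LEM → (M : QTModel) →
    (∀ x y v w → Notions.Addtally M x y v → Notions.Addtally M x y w → v ≡ w)
    × (∀ x → Notions.Tally M x → Notions.Addtally M x (QTModel.b M) x)
    × (∀ y → Notions.Tally M y → Notions.Addtally M (QTModel.b M) y y)
    × (∀ x → Notions.Tally M x → Notions.Addtally M x (Notions.bb M) (QTModel.S M x))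
    × (∀ x y z → Notions.Tally M x → Notions.Tally M y → Notions.Addtally M x y z
    → Notions.Addtally M x (QTModel._*_ M y (QTModel.b M)) (QTModel._*_ M z (QTModel.b M)))
mainTheorem6 _ M =
    (λ _ _ _ _ → Addtally-functional)
  , (λ _ → Addtally-b-right)
  , (λ _ → Addtally-b-left)
  , (λ _ → Addtally-bb)
  , (λ _ _ _ → Addtally-*b)
  where
  open QTProperties M
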